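{- There is a category $\mathbf{Graph}_{LP}$ whose objects are connected graphs and whose morphisms are the strongly line-proper morphisms. There is a functor $L:\mathbf{Graph}_{LP}\to\mathbf{Graph}_{SP}$ that maps each graph $G$ to its line graph $L(G)$ and each strongly line-proper morphism $\phi:G_1\to G_2$ to a strongly proper morphism $L(\phi):L(G_1)\to L(G_2)$ such that $L(\phi)(\{u,v\})=\{\phi(u),\phi(v)\}$ for every edge $\{u,v\}\in E(G_1)$.
   Context: Graphs are simple and undirected, possibly infinite. A graph homomorphism is a map of vertex sets sending adjacent vertices to adjacent vertices. A 1-complex morphism is a map of vertex sets sending adjacent vertices either to adjacent vertices or to a single vertex. Composition is composition of maps. Line graph. $L(G)$ is the graph with vertex set $E(G)$ in which two distinct edges of $G$ are adjacent exactly when they share a vertex. Strongly line-proper. A graph homomorphism $\phi:G_1\to G_2$ between connected graphs is strongly line-proper if for every edge $e\in E(G_2)$ the set $L(\phi)^{ -1}(e)$ of edges $\{u,v\}\in E(G_1)$ with $\{\phi(u),\phi(v)\}=e$ is finite. Strongly proper. A ray is a one-way infinite path without repeated vertices. A set $U\subset V(G)$ is dispersed if for every ray $r$ of $G$ there is a finite $F\subset V(G)$ such that the connected component of $G\setminus F$ containing a tail of $r$ is disjoint from $U$. A 1-complex morphism $\psi:H_1\to H_2$ is strongly proper if $\psi^{ -1}(v)$ is dispersed for every $v\in V(H_2)$. $\mathbf{Graph}_{SP}$ is the category of connected graphs with strongly proper morphisms (strongly proper morphisms are closed under composition). -}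

module Defs where

open import Axiom.ExcludedMiddle using (ExcludedMiddle)
open import Data.Empty using (⊥-elim)
open import Data.List.Base using (List; []; _∷_; _++_)
open import Data.List.Relation.Unary.Any using (here; there)
import Data.List.Membership.Setoid as Membership
import Data.List.Membership.Setoid.Properties as Membershipₚ
open import Data.Nat.Base as ℕ using (ℕ; zero; suc; _≤_; _<_; _⊔_; z≤n; s≤s)
import Data.Nat.Properties as ℕₚ
open import Data.Product.Base
  using (Σ; Σ-syntax; ∃; ∃-syntax; _×_; _,_; proj₁; proj₂; uncurry)
open import Data.Sum.Base as Sum using (_⊎_; inj₁; inj₂)
open import Function.Base using (_∘_; _on_)
open import Function.Bundles using (Func; _⇔_)
import Function.Construct.Composition as Composition
import Function.Construct.Identity as Identity
open import Level as Level using (Level) renaming (_⊔_ to _⊔ˡ_)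
open import Relation.Binary.Bundles using (Setoid)
open import Relation.Binary.Core using (Rel)
open import Relation.Binary.Definitions
  using (Symmetric; Irreflexive; _Respects₂_; tri<; tri≈; tri>)
import Relation.Binary.Construct.On as On
open import Relation.Binary.Construct.Closure.ReflexiveTransitive
  using (Star; ε; _◅_; _◅◅_; gmap; reverse)
open import Relation.Binary.Construct.Union using (_∪_)
open import Relation.Binary.PropositionalEquality.Core as ≡ using (_≡_)
open import Relation.Nullary.Decidable.Core using (yes; no)
open import Relation.Nullary.Negation.Core using (¬_)
open import Relation.Unary using (Pred)

private
  variable
    a b ℓ : Level

record Category (o m e : Level) : Set (Level.suc (o ⊔ˡ m ⊔ˡ e)) where
  infixr 9 _⊚_
  field
    Obj : Set o
    Hom : Obj → Obj → Setoid m e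

  _⇒_ : Obj → Obj → Set m
  A ⇒ B = Setoid.Carrier (Hom A B)

  _≈_ : ∀ {A B} → Rel (A ⇒ B) e
  _≈_ {A} {B} = Setoid._≈_ (Hom A B)

  field
    id        : ∀ {A} → A ⇒ A
    _⊚_       : ∀ {A B C} → B ⇒ C → A ⇒ B → A ⇒ C
    ⊚-cong    : ∀ {A B C} {g g′ : B ⇒ C} {f f′ : A ⇒ B} →
                g ≈ g′ → f ≈ f′ → (g ⊚ f) ≈ (g′ ⊚ f′)
    assoc     : ∀ {A B C D} {h : C ⇒ D} {g : B ⇒ C} {f : A ⇒ B} →
                ((h ⊚ g) ⊚ f) ≈ (h ⊚ (g ⊚ f))
    identityˡ : ∀ {A B} {f : A ⇒ B} → (id ⊚ f) ≈ f
    identityʳ : ∀ {A B} {f : A ⇒ B} → (f ⊚ id) ≈ f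

-- Functors with a prescribed action F₀ on objects.
record FunctorOn {o m e o′ m′ e′} (C : Category o m e) (D : Category o′ m′ e′)
                 (F₀ : Category.Obj C → Category.Obj D)
                 : Set (o ⊔ˡ m ⊔ˡ e ⊔ˡ m′ ⊔ˡ e′) where
  private
    module C = Category C
    module D = Category D
  field
    F₁      : ∀ {A B} → A C.⇒ B → F₀ A D.⇒ F₀ B
    F₁-cong : ∀ {A B} {f g : A C.⇒ B} → f C.≈ g → F₁ f D.≈ F₁ g
    F₁-id   : ∀ {A} → F₁ (C.id {A}) D.≈ D.id
    F₁-⊚    : ∀ {A B C} {g : B C.⇒ C} {f : A C.⇒ B} →
              F₁ (g C.⊚ f) D.≈ (F₁ g D.⊚ F₁ f)

module _ {o m e} (C : Category o m e) where
  open Category C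

  -- Closure is only asked of morphisms between objects satisfying O.
  record IsSubcategory (O : Pred Obj a) (P : ∀ {A B} → Pred (A ⇒ B) b)
                       : Set (o ⊔ˡ m ⊔ˡ a ⊔ˡ b) where
    field
      id-closed : ∀ {A} → O A → P (id {A})
      ⊚-closed  : ∀ {A B C} → O A → O B → O C → {g : B ⇒ C} {f : A ⇒ B} →
                  P g → P f → P (g ⊚ f)

  subcategory : {O : Pred Obj a} {P : ∀ {A B} → Pred (A ⇒ B) b} →
                IsSubcategory O P → Category (o ⊔ˡ a) (m ⊔ˡ b) e
  subcategory {O = O} {P = P} sub = record
    { Obj       = Σ Obj O
    ; Hom       = λ (A , _) (B , _) →
                  On.setoid {B = Σ[ f ∈ (A ⇒ B) ] P f} (Hom A B) proj₁
    ; id        = λ {A} → id , id-closed (proj₂ A)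
    ; _⊚_       = λ {A} {B} {C} (g , Pg) (f , Pf) →
                  g ⊚ f , ⊚-closed (proj₂ A) (proj₂ B) (proj₂ C) Pg Pf
    ; ⊚-cong    = ⊚-cong
    ; assoc     = assoc
    ; identityˡ = identityˡ
    ; identityʳ = identityʳ
    }
    where open IsSubcategory sub

-- The vertices form a setoid so that the edges of a graph, being
-- unordered pairs, can serve as the vertices of its line graph.
record Graph (ℓ : Level) : Set (Level.suc ℓ) where
  infix 4 _~_
  field
    vertices : Setoid ℓ ℓ

  open Setoid vertices public
    using (_≈_) renaming (Carrier to V; refl to ≈-refl; sym to ≈-sym; trans to ≈-trans)

  field
    _~_      : Rel V ℓ
    ~-resp-≈ : _~_ Respects₂ _≈_
    ~-sym    : Symmetric _~_
    ~-irrefl : Irreflexive _≈_ _~_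

  -- Walks; the ≈-steps do not move.
  Reachable : Rel V ℓ
  Reachable = Star (_≈_ ∪ _~_)

  open Membership vertices public using (_∈_; _∉_)

open Graph using (V; vertices)

-- The empty graph counts as connected: it is the line graph of the
-- one-vertex graph.
Connected : Graph ℓ → Set ℓ
Connected G = ∀ x y → Reachable x y
  where open Graph G

Finite : (S : Setoid ℓ ℓ) → Pred (Setoid.Carrier S) ℓ → Set ℓ
Finite S P = ∃[ xs ] (∀ x → P x ⇔ x ∈ xs)
  where open Membership S

record GraphHom (G H : Graph ℓ) : Set ℓ where
  private
    module G = Graph G
    module H = Graph H
  field
    func      : Func (vertices G) (vertices H)
  open Func func public using (to; cong)
  field
    preserves : ∀ {x y} → x G.~ y → to x H.~ to y

record ComplexMorphism (G H : Graph ℓ) : Set ℓ where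
  private
    module G = Graph G
    module H = Graph H
  field
    func      : Func (vertices G) (vertices H)
  open Func func public using (to; cong)
  field
    preserves : ∀ {x y} → x G.~ y → to x H.≈ to y ⊎ to x H.~ to y

Graphs : ∀ ℓ → Category (Level.suc ℓ) ℓ ℓ
Graphs ℓ = record
  { Obj       = Graph ℓ
  ; Hom       = λ G H → record
    { Carrier       = GraphHom G H
    ; _≈_           = λ φ ψ → ∀ x → Graph._≈_ H (to φ x) (to ψ x)
    ; isEquivalence = record
      { refl  = λ x → Graph.≈-refl H
      ; sym   = λ p x → Graph.≈-sym H (p x)
      ; trans = λ p q x → Graph.≈-trans H (p x) (q x)
      }
    }
  ; id        = λ {G} → record
    { func = Identity.function (vertices G) ; preserves = λ xy → xy }
  ; _⊚_       = λ ψ φ → record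
    { func      = Composition.function (func φ) (func ψ)
    ; preserves = λ xy → preserves ψ (preserves φ xy)
    }
  ; ⊚-cong    = λ {_} {_} {K} {ψ} {_} {_} {φ′} p q x →
                Graph.≈-trans K (cong ψ (q x)) (p (to φ′ x))
  ; assoc     = λ {_} {_} {_} {K} x → Graph.≈-refl K
  ; identityˡ = λ {_} {H} x → Graph.≈-refl H
  ; identityʳ = λ {_} {H} x → Graph.≈-refl H
  }
  where open GraphHom

Complexes : ∀ ℓ → Category (Level.suc ℓ) ℓ ℓ
Complexes ℓ = record
  { Obj       = Graph ℓ
  ; Hom       = λ G H → record
    { Carrier       = ComplexMorphism G H
    ; _≈_           = λ φ ψ → ∀ x → Graph._≈_ H (to φ x) (to ψ x)
    ; isEquivalence = record
      { refl  = λ x → Graph.≈-refl H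
      ; sym   = λ p x → Graph.≈-sym H (p x)
      ; trans = λ p q x → Graph.≈-trans H (p x) (q x)
      }
    }
  ; id        = λ {G} → record
    { func = Identity.function (vertices G) ; preserves = inj₂ }
  ; _⊚_       = λ ψ φ → record
    { func      = Composition.function (func φ) (func ψ)
    ; preserves = λ xy → Sum.[ inj₁ ∘ cong ψ , preserves ψ ] (preserves φ xy)
    }
  ; ⊚-cong    = λ {_} {_} {K} {ψ} {_} {_} {φ′} p q x →
                Graph.≈-trans K (cong ψ (q x)) (p (to φ′ x))
  ; assoc     = λ {_} {_} {_} {K} x → Graph.≈-refl K
  ; identityˡ = λ {_} {H} x → Graph.≈-refl H
  ; identityʳ = λ {_} {H} x → Graph.≈-refl H
  }
  where open ComplexMorphism

module _ (G : Graph ℓ) where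
  open Graph G hiding (V)

  Edge : Set ℓ
  Edge = Σ[ x ∈ V G ] Σ[ y ∈ V G ] x ~ y

  _≈ᴱ_ : Rel Edge ℓ
  (x , y , _) ≈ᴱ (x′ , y′ , _) = (x ≈ x′ × y ≈ y′) ⊎ (x ≈ y′ × y ≈ x′)

  edges : Setoid ℓ ℓ
  edges = record
    { Carrier       = Edge
    ; _≈_           = _≈ᴱ_
    ; isEquivalence = record
      { refl  = inj₁ (≈-refl , ≈-refl)
      ; sym   = λ where
          (inj₁ (p , q)) → inj₁ (≈-sym p , ≈-sym q)
          (inj₂ (p , q)) → inj₂ (≈-sym q , ≈-sym p)
      ; trans = λ where
          (inj₁ (p , q)) (inj₁ (r , s)) → inj₁ (≈-trans p r , ≈-trans q s)
          (inj₁ (p , q)) (inj₂ (r , s)) → inj₂ (≈-trans p r , ≈-trans q s)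
          (inj₂ (p , q)) (inj₁ (r , s)) → inj₂ (≈-trans p s , ≈-trans q r)
          (inj₂ (p , q)) (inj₂ (r , s)) → inj₁ (≈-trans p s , ≈-trans q r)
      }
    }

  _isEndOf_ : V G → Edge → Set ℓ
  w isEndOf (x , y , _) = w ≈ x ⊎ w ≈ y

  isEndOf-resp : ∀ {w e f} → e ≈ᴱ f → w isEndOf e → w isEndOf f
  isEndOf-resp (inj₁ (p , q)) (inj₁ r) = inj₁ (≈-trans r p)
  isEndOf-resp (inj₁ (p , q)) (inj₂ r) = inj₂ (≈-trans r q)
  isEndOf-resp (inj₂ (p , q)) (inj₁ r) = inj₂ (≈-trans r p)
  isEndOf-resp (inj₂ (p , q)) (inj₂ r) = inj₁ (≈-trans r q)

  lineGraph : Graph ℓ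
  lineGraph = record
    { vertices = edges
    ; _~_      = λ e f → ¬ (e ≈ᴱ f) × ∃[ w ] (w isEndOf e × w isEndOf f)
    ; ~-resp-≈ =
        (λ {e} {f} {f′} p (e≉f , w , we , wf) →
          (λ e≈f′ → e≉f (trans {e} {f′} {f} e≈f′ (sym {f} {f′} p))) ,
          w , we , isEndOf-resp {w} {f} {f′} p wf) ,
        (λ {f} {e} {e′} p (e≉f , w , we , wf) →
          (λ e′≈f → e≉f (trans {e} {e′} {f} p e′≈f)) ,
          w , isEndOf-resp {w} {e} {e′} p we , wf)
    ; ~-sym    = λ {e} {f} (e≉f , w , we , wf) →
                 (λ f≈e → e≉f (sym {f} {e} f≈e)) , w , wf , we
    ; ~-irrefl = λ e≈f (e≉f , _) → e≉f e≈f
    }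
    where open Setoid edges using (sym; trans)

mapEdge : {G H : Graph ℓ} → GraphHom G H → Edge G → Edge H
mapEdge φ (x , y , xy) = to x , to y , preserves xy
  where open GraphHom φ

StronglyLineProper : {G H : Graph ℓ} → Pred (GraphHom G H) ℓ
StronglyLineProper {G = G} {H} φ =
  ∀ (e : Edge H) → Finite (edges G) (λ d → _≈ᴱ_ H (mapEdge φ d) e)

_∖_ : (G : Graph ℓ) → List (V G) → Graph ℓ
G ∖ F = record
  { vertices = On.setoid {B = Σ[ x ∈ G.V ] x G.∉ F} G.vertices proj₁
  ; _~_      = G._~_ on proj₁
  ; ~-resp-≈ = proj₁ G.~-resp-≈ , proj₂ G.~-resp-≈
  ; ~-sym    = G.~-sym
  ; ~-irrefl = G.~-irrefl
  }
  where module G = Graph G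

module _ (G : Graph ℓ) where
  open Graph G hiding (V)

  record Ray : Set ℓ where
    field
      at        : ℕ → V G
      adjacent  : ∀ n → at n ~ at (suc n)
      injective : ∀ {m n} → at m ≈ at n → m ≡ n

  open Ray

  -- A connected component of G ∖ F is given by any of its vertices; the
  -- component containing the tail at N, at (N+1), … is that of at N.
  Dispersed : Pred (Pred (V G) ℓ) ℓ
  Dispersed U = ∀ (r : Ray) →
    ∃[ F ] ∃[ N ] Σ[ tail ∈ (∀ n → N ≤ n → at r n ∉ F) ]
      (∀ u → Graph.Reachable (G ∖ F) (at r N , tail N ℕₚ.≤-refl) u → ¬ U (proj₁ u))

StronglyProper : {G H : Graph ℓ} → Pred (ComplexMorphism G H) ℓ
StronglyProper {G = G} {H} ψ = ∀ v → Dispersed G (λ x → Graph._≈_ H (to x) v)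
  where open ComplexMorphism ψ

-- Strongly proper morphisms are closed under composition.  Given a ray r
-- and a strongly proper ψ, the lazy walk ψ ∘ r visits every vertex finitely
-- often, so erasing its loops leaves a ray r′; the image of a component
-- that avoids ψ⁻¹(F) lies in the component of r′ avoiding F.  Finding last
-- visits is where excluded middle comes in.

module _ (G : Graph ℓ) (F : List (V G)) where
  open Graph G hiding (V)

  segment : (s : ℕ → V G) → (∀ n → (s n ≈ s (suc n)) ⊎ (s n ~ s (suc n))) →
            ∀ {N} (avoid : ∀ n → N ≤ n → s n ∉ F) →
            ∀ {m n} → m ℕ.≤′ n → (N≤m : N ≤ m) (p : s n ∉ F) →
            Graph.Reachable (G ∖ F) (s m , avoid m N≤m) (s n , p)
  segment s step avoid ℕ.≤′-refl N≤m p = inj₁ ≈-refl ◅ ε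
  segment s step avoid (ℕ.≤′-step {n} m≤n) N≤m p =
    segment s step avoid m≤n N≤m
      (avoid n (ℕₚ.≤-trans N≤m (ℕₚ.≤′⇒≤ m≤n))) ◅◅ (step n ◅ ε)

  Reachable-sym : Symmetric (Graph.Reachable (G ∖ F))
  Reachable-sym = reverse Sum.[ inj₁ ∘ ≈-sym , inj₂ ∘ ~-sym ]

Reachable-mono : (G : Graph ℓ) {F F′ : List (V G)} →
                 (sub : ∀ {x} → Graph._∉_ G x F → Graph._∉_ G x F′) →
                 ∀ {x y} → Graph.Reachable (G ∖ F) x y →
                 Graph.Reachable (G ∖ F′) (proj₁ x , sub (proj₂ x)) (proj₁ y , sub (proj₂ y))
Reachable-mono G sub = gmap (λ (x , p) → x , sub p) (λ s → s)

module StronglyProperComposition (em : ExcludedMiddle ℓ) where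

  id-stronglyProper : {G : Graph ℓ} →
                      StronglyProper {G = G} {G} (Category.id (Complexes ℓ))
  id-stronglyProper {G} v r with em {P = ∃[ n ] (Graph._≈_ G (Ray.at r n) v)}
  ... | yes (n , rn≈v) = v ∷ [] , suc n ,
        (λ where
          m n<m (here rm≈v) → ℕₚ.<-irrefl (injective (≈-trans rn≈v (≈-sym rm≈v))) n<m) ,
        λ (u , u∉) _ u≈v → u∉ (here u≈v)
    where open Graph G
          open Ray r
  ... | no ∄n = v ∷ [] , 0 ,
        (λ where n _ (here rn≈v) → ∄n (n , rn≈v)) ,
        λ (u , u∉) _ u≈v → u∉ (here u≈v)

  -- A lazy walk that visits each vertex finitely often contains a ray.
  module LoopErasure (G : Graph ℓ) (s : ℕ → V G)
    (step : ∀ n → Graph._≈_ G (s n) (s (suc n)) ⊎ Graph._~_ G (s n) (s (suc n)))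
    (leaves : ∀ v → ∃[ N ] (∀ n → N ≤ n → ¬ Graph._≈_ G (s n) v)) where

    open Graph G hiding (V)

    LastVisit : V G → ℕ → Set ℓ
    LastVisit v k = s k ≈ v × (∀ n → k < n → ¬ (s n ≈ v))

    search : ∀ {v m} → s m ≈ v → ∀ N → (∀ n → N ≤ n → ¬ (s n ≈ v)) → ∃ (LastVisit v)
    search {m = m} p zero    q = ⊥-elim (q m z≤n p)
    search {v} {m} p (suc N) q with em {P = s N ≈ v}
    ... | yes sN≈v = N , sN≈v , q
    ... | no  sN≉v = search p N λ n N≤n → Sum.[ q n , (λ where ≡.refl → sN≉v) ] (ℕₚ.m≤n⇒m<n∨m≡n N≤n)

    lastVisit : ∀ m → ∃ (LastVisit (s m))
    lastVisit m = uncurry (search ≈-refl) (leaves (s m))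

    last : ℕ → ℕ
    last m = proj₁ (lastVisit m)

    m≤last : ∀ m → m ≤ last m
    m≤last m = ℕₚ.≮⇒≥ λ l<m → proj₂ (proj₂ (lastVisit m)) m l<m ≈-refl

    time : ℕ → ℕ
    time zero    = last 0
    time (suc n) = last (suc (time n))

    time-final : ∀ i n → time i < n → ¬ (s n ≈ s (time i))
    time-final zero    n t<n p =
      proj₂ (proj₂ (lastVisit 0)) n t<n (≈-trans p (proj₁ (proj₂ (lastVisit 0))))
    time-final (suc i) n t<n p =
      proj₂ (proj₂ l) n t<n (≈-trans p (proj₁ (proj₂ l)))
      where l = lastVisit (suc (time i))

    time-mono : ∀ {i j} → i ℕ.<′ j → time i < time j
    time-mono {i} ℕ.≤′-refl         = m≤last (suc (time i))
    time-mono     (ℕ.≤′-step {j} p) = ℕₚ.<-trans (time-mono p) (m≤last (suc (time j)))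

    i≤time : ∀ i → i ≤ time i
    i≤time zero    = z≤n
    i≤time (suc i) = ℕₚ.≤-trans (s≤s (i≤time i)) (m≤last (suc (time i)))

    ray : Ray G
    ray = record
      { at        = s ∘ time
      ; adjacent  = adj
      ; injective = inj
      }
      where
      adj : ∀ n → s (time n) ~ s (time (suc n))
      adj n with step (time n)
      ... | inj₁ p = ⊥-elim (time-final n (suc (time n)) ℕₚ.≤-refl (≈-sym p))
      ... | inj₂ p = proj₁ ~-resp-≈ (≈-sym (proj₁ (proj₂ (lastVisit (suc (time n)))))) p

      inj : ∀ {m n} → s (time m) ≈ s (time n) → m ≡ n
      inj {m} {n} p with ℕₚ.<-cmp m n
      ... | tri< m<n _ _ = ⊥-elim (time-final m (time n) (time-mono (ℕₚ.≤⇒≤′ m<n)) (≈-sym p))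
      ... | tri≈ _ m≡n _ = m≡n
      ... | tri> _ _ n<m = ⊥-elim (time-final n (time m) (time-mono (ℕₚ.≤⇒≤′ n<m)) p)

  module _ {G H : Graph ℓ} (ψ : ComplexMorphism G H) (ψ-proper : StronglyProper ψ) where
    open ComplexMorphism ψ
    private
      module G = Graph G
      module H = Graph H

    module _ (r : Ray G) where
      open Ray r

      ray-segment : ∀ {F N} (avoid : ∀ n → N ≤ n → at n G.∉ F) →
                    ∀ {m n} → m ≤ n → (N≤m : N ≤ m) (p : at n G.∉ F) →
                    Graph.Reachable (G ∖ F) (at m , avoid m N≤m) (at n , p)
      ray-segment {F} avoid m≤n =
        segment G F at (λ n → inj₂ (adjacent n)) avoid (ℕₚ.≤⇒≤′ m≤n)

      leaves : ∀ v → ∃[ N ] (∀ n → N ≤ n → ¬ (to (at n) H.≈ v))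
      leaves v with ψ-proper v r
      ... | F , N , tail , disjoint =
        N , λ n N≤n → disjoint _ (ray-segment tail N≤n ℕₚ.≤-refl (tail n N≤n))

      avoidAll : ∀ (F′ : List (V H)) →
        ∃[ F ] ∃[ N ] Σ[ tail ∈ (∀ n → N ≤ n → at n G.∉ F) ]
          (∀ u → Graph.Reachable (G ∖ F) (at N , tail N ℕₚ.≤-refl) u → to (proj₁ u) H.∉ F′)
      avoidAll []       = [] , 0 , (λ _ _ ()) , (λ _ _ ())
      avoidAll (v ∷ F′) with ψ-proper v r | avoidAll F′
      ... | F₁ , N₁ , tail₁ , disj₁ | F₂ , N₂ , tail₂ , disj₂ =
        F₁ ++ F₂ , N₁ ⊔ N₂ , tail , disj
        where
        left : ∀ {x} → x G.∉ (F₁ ++ F₂) → x G.∉ F₁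
        left x∉ x∈ = x∉ (Membershipₚ.∈-++⁺ˡ G.vertices x∈)

        right : ∀ {x} → x G.∉ (F₁ ++ F₂) → x G.∉ F₂
        right x∉ x∈ = x∉ (Membershipₚ.∈-++⁺ʳ G.vertices F₁ x∈)

        tail : ∀ n → N₁ ⊔ N₂ ≤ n → at n G.∉ (F₁ ++ F₂)
        tail n N≤n x∈ = Sum.[ tail₁ n (ℕₚ.m⊔n≤o⇒m≤o N₁ N₂ N≤n) , tail₂ n (ℕₚ.m⊔n≤o⇒n≤o N₁ N₂ N≤n) ]
                          (Membershipₚ.∈-++⁻ G.vertices F₁ x∈)

        disj : ∀ u → Graph.Reachable (G ∖ (F₁ ++ F₂)) (at (N₁ ⊔ N₂) , tail _ ℕₚ.≤-refl) u →
               to (proj₁ u) H.∉ (v ∷ F′)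
        disj u w (here p)  = disj₁ _
          (ray-segment tail₁ (ℕₚ.m≤m⊔n N₁ N₂) ℕₚ.≤-refl _ ◅◅ Reachable-mono G left w) p
        disj u w (there p) = disj₂ _
          (ray-segment tail₂ (ℕₚ.m≤n⊔m N₁ N₂) ℕₚ.≤-refl _ ◅◅ Reachable-mono G right w) p

    preimage-dispersed : (U : Pred (V H) ℓ) → Dispersed H U → Dispersed G (U ∘ to)
    preimage-dispersed U U-dispersed r = result (U-dispersed ray)
      where
      open Ray r
      open LoopErasure H (to ∘ at) (λ n → preserves (adjacent n)) (leaves r)

      result : (∃[ F ] ∃[ N ] Σ[ tail ∈ (∀ n → N ≤ n → Ray.at ray n H.∉ F) ]
                 (∀ u → Graph.Reachable (H ∖ F) (Ray.at ray N , tail N ℕₚ.≤-refl) u →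
                   ¬ U (proj₁ u))) →
               (∃[ F ] ∃[ N ] Σ[ tail ∈ (∀ n → N ≤ n → at n G.∉ F) ]
                 (∀ u → Graph.Reachable (G ∖ F) (at N , tail N ℕₚ.≤-refl) u →
                   ¬ U (to (proj₁ u))))
      result (F′ , N′ , tail′ , disj′) with avoidAll r F′
      ... | F , N , tail , avoid = F , N , tail , disj
        where
        image : ∀ {x y} (wx : Graph.Reachable (G ∖ F) (at N , tail N ℕₚ.≤-refl) x) →
                (q : to (proj₁ y) H.∉ F′) → Graph.Reachable (G ∖ F) x y →
                Graph.Reachable (H ∖ F′) (to (proj₁ x) , avoid x wx) (to (proj₁ y) , q)
        image wx q ε       = inj₁ H.≈-refl ◅ ε
        image wx q (e ◅ w) =
          Sum.[ inj₁ ∘ cong , preserves ]′ e ◅ image (wx ◅◅ (e ◅ ε)) q w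

        M : ℕ
        M = N ⊔ N′

        N≤tM : N ≤ time M
        N≤tM = ℕₚ.≤-trans (ℕₚ.m≤m⊔n N N′) (i≤time M)

        toTime : Graph.Reachable (G ∖ F) (at N , tail N ℕₚ.≤-refl) (at (time M) , tail _ N≤tM)
        toTime = ray-segment r tail N≤tM ℕₚ.≤-refl _

        disj : ∀ u → Graph.Reachable (G ∖ F) (at N , tail N ℕₚ.≤-refl) u → ¬ U (to (proj₁ u))
        disj u w = disj′ (to (proj₁ u) , avoid u w)
          (segment H F′ (Ray.at ray) (λ n → inj₂ (Ray.adjacent ray n)) tail′
             (ℕₚ.≤⇒≤′ (ℕₚ.m≤n⊔m N N′)) ℕₚ.≤-refl (avoid _ toTime)
           ◅◅ image toTime (avoid u w) (Reachable-sym G F toTime ◅◅ w))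

  stronglyProper-isSubcategory : IsSubcategory (Complexes ℓ) Connected StronglyProper
  stronglyProper-isSubcategory = record
    { id-closed = λ {G} _ → id-stronglyProper {G}
    ; ⊚-closed  = λ _ _ _ {χ} {ψ} χ-proper ψ-proper v →
                  preimage-dispersed ψ ψ-proper _ (χ-proper v)
    }

GraphLP : IsSubcategory (Graphs ℓ) Connected StronglyLineProper →
          Category (Level.suc ℓ) ℓ ℓ
GraphLP = subcategory (Graphs _)

GraphSP : ExcludedMiddle ℓ → Category (Level.suc ℓ) ℓ ℓ
GraphSP em = subcategory (Complexes _)
  (StronglyProperComposition.stronglyProper-isSubcategory em)

{-# OPTIONS --safe #-}

-- A walk in G is turned into a walk in L(G) by replacing each step x ~ y by
-- the edge {x, y}: consecutive edges share a vertex, hence are equal or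
-- adjacent.  For strong properness, the fibres of L(φ) are finite by
-- hypothesis, and a finite set is dispersed.

module Submission where

open import Defs
open import Axiom.ExcludedMiddle using (ExcludedMiddle)
open import Data.List.Base using ([]; _∷_; _++_)
open import Data.List.Relation.Unary.Any using (here; there)
import Data.List.Membership.Setoid as Membership
import Data.List.Membership.Setoid.Properties as Membershipₚ
open import Data.Product.Base using (Σ; Σ-syntax; ∃-syntax; _×_; _,_; proj₁; proj₂)
open import Data.Sum.Base as Sum using (_⊎_; inj₁; inj₂)
open import Function.Base using (_∘_)
open import Function.Bundles using (Equivalence; mk⇔)
open import Level using (Level)
open import Relation.Binary.Bundles using (Setoid)
open import Relation.Binary.Construct.Closure.ReflexiveTransitive using (ε; _◅_)
open import Relation.Nullary.Decidable.Core using (yes; no)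
open import Relation.Unary using (Pred)

private
  variable
    ℓ : Level

module _ {G H : Graph ℓ} (φ : GraphHom G H) where
  open GraphHom φ

  mapEdge-cong : ∀ {d e} → _≈ᴱ_ G d e → _≈ᴱ_ H (mapEdge φ d) (mapEdge φ e)
  mapEdge-cong = Sum.map (λ (p , q) → cong p , cong q) (λ (p , q) → cong p , cong q)

  isEndOf-map : ∀ {w} e → _isEndOf_ G w e → _isEndOf_ H (to w) (mapEdge φ e)
  isEndOf-map _ = Sum.map cong cong

Finite-singleton : (S : Setoid ℓ ℓ) (y : Setoid.Carrier S) →
                   Finite S (λ x → Setoid._≈_ S x y)
Finite-singleton S y = y ∷ [] , λ x → mk⇔ here λ { (here p) → p ; (there ()) }

module _ (S T : Setoid ℓ ℓ) where
  private
    module S = Setoid S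
    module T = Setoid T
  open Membership T using () renaming (_∈_ to _∈ᵀ_)

  -- Induction on the list enumerating `Q`: the preimage of `y ∷ ys` is the fibre over `y` together
  -- with the preimage of `ys`, so the two enumerations are concatenated.
  Finite-preimage : {f : S.Carrier → T.Carrier} →
                    (∀ y → Finite S (λ x → f x T.≈ y)) →
                    {Q : Pred T.Carrier ℓ} → Finite T Q → Finite S (Q ∘ f)
  Finite-preimage {f} fibre {Q} (ys , Q⇔∈ys) with lift ys
    where
    lift : ∀ ys → Finite S (λ x → f x ∈ᵀ ys)
    lift []       = [] , λ x → mk⇔ (λ ()) (λ ())
    lift (y ∷ ys) with fibre y | lift ys
    ... | zs , ∈zs | xs , ∈xs = zs ++ xs , λ x → mk⇔
      (λ where
        (here p)  → Membershipₚ.∈-++⁺ˡ S (Equivalence.to (∈zs x) p)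
        (there p) → Membershipₚ.∈-++⁺ʳ S zs (Equivalence.to (∈xs x) p))
      (λ p → Sum.[ here ∘ Equivalence.from (∈zs x)
                 , there ∘ Equivalence.from (∈xs x) ]
               (Membershipₚ.∈-++⁻ S zs p))
  ... | xs , ∈xs = xs , λ x → mk⇔
    (Equivalence.to (∈xs x) ∘ Equivalence.to (Q⇔∈ys (f x)))
    (Equivalence.from (Q⇔∈ys (f x)) ∘ Equivalence.from (∈xs x))

stronglyLineProper-isSubcategory :
  IsSubcategory (Graphs ℓ) Connected StronglyLineProper
stronglyLineProper-isSubcategory = record
  { id-closed = λ {G} _ → Finite-singleton (edges G)
  -- The fibre of the composite over `e` is the preimage under `mapEdge φ` of the fibre of
  -- `mapEdge ψ` over `e`.
  ; ⊚-closed  = λ {G} {H} _ _ _ {ψ} {φ} ψ-proper φ-proper e →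
                Finite-preimage (edges G) (edges H) {mapEdge φ} φ-proper (ψ-proper e)
  }

module _ (em : ExcludedMiddle ℓ) where

  -- Adjacency in the line graph requires distinct edges, so excluded middle decides whether `d` and
  -- `e` coincide. The resulting sum is both a step of a walk and what a 1-complex morphism has to
  -- produce.
  sharing : (G : Graph ℓ) (d e : Edge G) →
            ∃[ w ] (_isEndOf_ G w d × _isEndOf_ G w e) →
            _≈ᴱ_ G d e ⊎ Graph._~_ (lineGraph G) d e
  sharing G d e shared with em {P = _≈ᴱ_ G d e}
  ... | yes d≈e = inj₁ d≈e
  ... | no  d≉e = inj₂ (d≉e , shared)

  lineGraph-connected : (G : Graph ℓ) → Connected G → Connected (lineGraph G)
  lineGraph-connected G connected d@(x , _) e@(y , _) =
    along d (inj₁ ≈-refl) (connected x y)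
    where
    open Graph G

    -- Invariant: the current vertex of the walk in `G` is an end of `d`, the edge reached so far in
    -- the line graph.
    along : ∀ {x} d → _isEndOf_ G x d → Reachable x y →
            Graph.Reachable (lineGraph G) d e
    -- The walk has arrived at `y`, the first end of `e`, so `d` and `e` share `y`.
    along d xd ε              = sharing G d e (_ , xd , inj₁ ≈-refl) ◅ ε
    along d xd (inj₁ x≈z ◅ w) =
      along d (Sum.map (≈-trans (≈-sym x≈z)) (≈-trans (≈-sym x≈z)) xd) w
    along d xd (inj₂ x~z ◅ w) =
      sharing G d (_ , _ , x~z) (_ , xd , inj₁ ≈-refl) ◅
      along (_ , _ , x~z) (inj₂ ≈-refl) w

  open StronglyProperComposition em using (avoidAll; id-stronglyProper)

  -- Single vertices are dispersed because the identity is strongly proper. Applied to the identity,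
  -- `avoidAll` merges the finite sets obtained for the members of `xs` into one that works for all
  -- of them.
  Finite⇒Dispersed : (G : Graph ℓ) {U : Pred (Graph.V G) ℓ} →
                     Finite (Graph.vertices G) U → Dispersed G U
  Finite⇒Dispersed G (xs , U⇔∈xs) r
    with avoidAll (Category.id (Complexes ℓ) {G}) (id-stronglyProper {G}) r xs
  ... | F , N , tail , disjoint =
    F , N , tail , λ u w Uu → disjoint u w (Equivalence.to (U⇔∈xs _) Uu)

  -- Only a 1-complex morphism in general: adjacent edges {u, w} and {w, v} have the same image when
  -- `φ` identifies u and v.
  lineMorphism : {G H : Graph ℓ} → GraphHom G H →
                 ComplexMorphism (lineGraph G) (lineGraph H)
  lineMorphism {G} {H} φ = record
    { func      = record
      { to   = mapEdge φ
      ; cong = λ {d} {e} → mapEdge-cong φ {d} {e}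
      }
    ; preserves = λ {d} {e} (_ , w , wd , we) →
        sharing H (mapEdge φ d) (mapEdge φ e)
          (GraphHom.to φ w , isEndOf-map φ d wd , isEndOf-map φ e we)
    }

  lineFunctor : FunctorOn (GraphLP stronglyLineProper-isSubcategory) (GraphSP em)
                          (λ (G , c) → lineGraph G , lineGraph-connected G c)
  lineFunctor = record
    { F₁      = λ {(G , _)} (φ , φ-proper) →
                lineMorphism φ , λ e → Finite⇒Dispersed (lineGraph G) (φ-proper e)
    ; F₁-cong = λ p (x , y , _) → inj₁ (p x , p y)
    -- `mapEdge` acts on each end separately, so identities and composites are preserved on the
    -- nose.
    ; F₁-id   = λ {(G , _)} d → Setoid.refl (edges G) {d}
    ; F₁-⊚    = λ {_} {_} {(K , _)} {(ψ , _)} {(φ , _)} d →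
                Setoid.refl (edges K) {mapEdge ψ (mapEdge φ d)}
    }

theorem21 : ∀ {ℓ} (em : ExcludedMiddle ℓ) →
    Σ[ lp ∈ IsSubcategory (Graphs ℓ) Connected StronglyLineProper ]
    Σ[ connected ∈ (∀ (G : Graph ℓ) → Connected G → Connected (lineGraph G)) ]
    Σ[ L ∈ FunctorOn (GraphLP lp) (GraphSP em) (λ (G , c) → lineGraph G , connected G c) ]
    (∀ {G₁ G₂ : Category.Obj (GraphLP lp)} (φ : Category._⇒_ (GraphLP lp) G₁ G₂)
    (u v : Graph.V (proj₁ G₁)) (uv : Graph._~_ (proj₁ G₁) u v) →
    _≈ᴱ_ (proj₁ G₂)
    (ComplexMorphism.to (proj₁ (FunctorOn.F₁ L {G₁} {G₂} φ)) (u , v , uv))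
    (GraphHom.to (proj₁ φ) u , GraphHom.to (proj₁ φ) v , GraphHom.preserves (proj₁ φ) uv))
theorem21 em =
  stronglyLineProper-isSubcategory , lineGraph-connected em , lineFunctor em ,
  λ {_} {(H , _)} φ u v uv → Setoid.refl (edges H) {mapEdge (proj₁ φ) (u , v , uv)}
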